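{- Let $n$ be a positive even integer. The digraph $\vec{C}_n \wr \vec{C}_3$ is not hamiltonian decomposable.
   Context: $\vec{C}_k$ denotes the directed $k$-cycle. A digraph is hamiltonian decomposable if its arc set can be partitioned into directed hamiltonian cycles. The wreath product $G \wr H$ has vertex set $V(G)\times V(H)$, with $((g_1,h_1),(g_2,h_2))$ an arc iff $(g_1,g_2)\in A(G)$, or $g_1=g_2$ and $(h_1,h_2)\in A(H)$. -}

module Defs where

open import Level using (0ℓ)
open import Data.Nat using (ℕ; zero; suc; _+_; _*_; _%_; NonZero)
open import Data.Fin using (Fin; toℕ; fromℕ<)
open import Data.Fin.Properties using ()
open import Data.Nat.DivMod using (m%n<n)
open import Data.Product using (Σ; ∃; ∃-syntax; _×_; _,_; proj₁; proj₂)
open import Data.Sum using (_⊎_)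
open import Relation.Binary.PropositionalEquality using (_≡_)
open import Function.Definitions using (Injective)

record Digraph : Set₁ where
  field
    size : ℕ
    Arc  : Fin size → Fin size → Set

open Digraph public

sucMod : {m : ℕ} → Fin m → Fin m
sucMod {suc m} i = fromℕ< (m%n<n (suc (toℕ i)) (suc m))

dcycle : (k : ℕ) → Digraph
dcycle k = record { size = k ; Arc = λ i j → sucMod i ≡ j }

open import Data.Fin using (combine; remQuot)

-- Wreath product G ≀ H, vertex (g , h) encoded as combine g h : Fin (|G| * |H|).
wreath : Digraph → Digraph → Digraph
wreath G H = record
  { size = size G * size H
  ; Arc  = λ x y →
      let (g₁ , h₁) = remQuot (size H) x
          (g₂ , h₂) = remQuot (size H) y
      in Arc G g₁ g₂ ⊎ (g₁ ≡ g₂ × Arc H h₁ h₂)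
  }

-- A directed hamiltonian cycle of D: an injective listing c of all vertices
-- (injective Fin |V| → Fin |V|, hence a bijection) such that each c i → c (i+1 mod |V|) is an arc.
record HamCycle (D : Digraph) : Set where
  field
    c      : Fin (size D) → Fin (size D)
    inj    : Injective _≡_ _≡_ c
    arcs   : ∀ i → Arc D (c i) (c (sucMod i))

open HamCycle public

UsesArc : {D : Digraph} → HamCycle D → Fin (size D) → Fin (size D) → Set
UsesArc C u v = ∃[ i ] (c C i ≡ u × c C (sucMod i) ≡ v)

record HamDecomposition (D : Digraph) : Set where
  field
    k        : ℕ
    cycles   : Fin k → HamCycle D
    covers   : ∀ u v → Arc D u v → ∃[ j ] UsesArc (cycles j) u v
    disjoint : ∀ u v (j j′ : Fin k) → UsesArc (cycles j) u v → UsesArc (cycles j′) u v → j ≡ j′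

HamiltonianDecomposable : Digraph → Set
HamiltonianDecomposable D = HamDecomposition D

module Submission where

-- Every vertex of Cₙ ≀ C₃ has out-degree 4, so a hamiltonian decomposition consists of four cycles,
-- each leaving every vertex by exactly one of its four arcs. A cycle uses the same number (0, 1 or 2)
-- of "along" arcs (i , x) → (i , x + 1) in every layer i, and these numbers add up to 3 over the four
-- cycles; so some cycle A crosses every layer by a permutation of C₃, and an odd number of cycles use
-- one along-arc per layer. Comparing, layer by layer, the cyclic order in which a cycle visits the
-- vertices shows that the signs of the permutations of A multiply to +1 over all layers, and that a
-- cycle with one along-arc per layer, which crosses each layer in two strands, swaps its strands an
-- odd number of times. A finite check over the arc patterns of one layer shows that the sign of A at
-- that layer is -1 to the number of cycles swapping their strands there plus the number of cycles
-- with two along-arcs. Multiplying over the n layers, n even, the right-hand sides give -1.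

open import Defs
open import Data.Nat using (ℕ; _*_; _>_)
open import Data.Nat.Divisibility using (_∣_; divides)
open import Relation.Nullary using (¬_)

open import Data.Bool using (if_then_else_)
open import Data.Fin using (Fin; zero; suc; toℕ; fromℕ; inject₁; punchOut; combine)
open import Data.Fin.Induction using (<-weakInduction)
open import Data.Fin.Permutation using (Permutation; Permutation′; permutation; _⟨$⟩ˡ_; inverseˡ; inverseʳ)
open import Data.Fin.Properties
  using ( any?; toℕ-injective; toℕ-fromℕ; toℕ-fromℕ<; toℕ≤pred[n]; toℕ-inject₁; toℕ<n
        ; punchOut-injective; injective⇒≤; combine-injective; combine-surjective; remQuot-combine )
  renaming (_≟_ to _≟ᶠ_)
open import Data.Nat using (zero; suc; pred; parity; _<_; _≤_; z≤n; s≤s; _<?_; _%_)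
open import Data.Nat.DivMod using (n%n≡0; m<n⇒m%n≡m)
open import Data.Nat.Properties
  using (n≮n; 1+n≢n; m≢1+n+m; suc-injective; <-cmp; <⇒≯; <⇒≢; ≤∧≢⇒<; ≤-pred; ≤-trans; n≤1+n; m≤n⇒m<n∨m≡n)
  renaming (_≟_ to _≟ⁿ_)
open import Data.Parity.Base using (Parity; 0ℙ; 1ℙ; _+_; _⁻¹)
open import Data.Parity.Properties
  using ( +-0-commutativeMonoid; +-identityʳ; +-comm; ⁻¹-involutive; ⁻¹-selfInverse; p+p≡0ℙ
        ; suc-homo-⁻¹; *-homo-*; *-zeroʳ )
  renaming (_≟_ to _≟ℙ_)
open import Algebra.Properties.CommutativeMonoid.Sum +-0-commutativeMonoid
  using (sum-syntax; sum-cong-≗; sum-replicate-zero; ∑-comm; ∑-distrib-+; ∑-permute)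
open import Algebra.Solver.CommutativeMonoid +-0-commutativeMonoid using (solve; _⊕_; _⊜_)
open import Data.Product using (∃; _×_; _,_; proj₁; proj₂)
open import Data.Sum using (_⊎_; inj₁; inj₂; fromInj₁) renaming (map to map-⊎)
open import Data.Vec using (Vec; []; _∷_; lookup; count; tabulate)
open import Data.Vec.Properties using (lookup∘tabulate)
open import Function using (_∘_)
open import Function.Bundles using (mk⇔)
open import Function.Definitions using (Injective)
open import Relation.Binary using (tri<; tri≈; tri>)
open import Relation.Binary.PropositionalEquality
  using (_≡_; _≢_; refl; sym; trans; cong; cong₂; subst; subst₂; module ≡-Reasoning)
open import Relation.Nullary using (Dec; yes; no; does; ¬?; _×-dec_; _⊎-dec_; _→-dec_; map′; from-yes; contradiction)
open import Relation.Nullary.Decidable using (dec-true; dec-false; does-⇔)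

injective⇒surjective : ∀ {N} (f : Fin N → Fin N) → Injective _≡_ _≡_ f → ∀ y → ∃ λ x → f x ≡ y
injective⇒surjective {suc M} f f-inj y with any? (λ x → f x ≟ᶠ y)
... | yes found = found
... | no ¬found = contradiction (injective⇒≤ g-inj) (n≮n M)
  where
  missed : ∀ x → y ≢ f x
  missed x y≡fx = ¬found (x , sym y≡fx)
  g : Fin (suc M) → Fin M
  g x = punchOut (missed x)
  g-inj : Injective _≡_ _≡_ g
  g-inj {x} {x′} gx≡gx′ = f-inj (punchOut-injective (missed x) (missed x′) gx≡gx′)

injective⇒permutation : ∀ {N} (f : Fin N → Fin N) → Injective _≡_ _≡_ f → Permutation′ N
injective⇒permutation f f-inj = permutation f (proj₁ ∘ onto) (proj₂ ∘ onto) (λ x → f-inj (proj₂ (onto (f x))))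
  where
  onto = injective⇒surjective f f-inj

injective⇒≢ : ∀ {A B : Set} {f : A → B} → Injective _≡_ _≡_ f → ∀ {x y} → x ≢ y → f x ≢ f y
injective⇒≢ f-inj x≢y = x≢y ∘ f-inj

cong₃ : ∀ {A B C D : Set} (f : A → B → C → D) {a a′ b b′ c c′} → a ≡ a′ → b ≡ b′ → c ≡ c′ → f a b c ≡ f a′ b′ c′
cong₃ f refl refl refl = refl

CyclicSuc : ℕ → ℕ → ℕ → Set
CyclicSuc M a b = (a < M × b ≡ suc a) ⊎ (a ≡ M × b ≡ 0)

toℕ-sucMod : ∀ {M} (x : Fin (suc M)) → CyclicSuc M (toℕ x) (toℕ (sucMod x))
toℕ-sucMod {M} x with m≤n⇒m<n∨m≡n (toℕ≤pred[n] x)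
... | inj₁ x<M = inj₁ (x<M , trans (toℕ-fromℕ< _) (m<n⇒m%n≡m (s≤s x<M)))
... | inj₂ x≡M = inj₂ (x≡M , trans (toℕ-fromℕ< _) (trans (cong (λ m → suc m % suc M) x≡M) (n%n≡0 (suc M))))

cyclicSuc-injective : ∀ {M a b c} → CyclicSuc M a c → CyclicSuc M b c → a ≡ b
cyclicSuc-injective (inj₁ (_ , refl)) (inj₁ (_ , c≡1+b)) = suc-injective c≡1+b
cyclicSuc-injective (inj₁ (_ , refl)) (inj₂ (_ , ()))
cyclicSuc-injective (inj₂ (_ , refl)) (inj₁ (_ , ()))
cyclicSuc-injective (inj₂ (refl , _)) (inj₂ (refl , _)) = refl

cyclicSuc-no-3-cycle : ∀ {M a b c} → 3 ≤ M → CyclicSuc M a b → CyclicSuc M b c → ¬ CyclicSuc M c a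
cyclicSuc-no-3-cycle _ (inj₁ (_ , refl)) (inj₁ (_ , refl)) (inj₁ (_ , a≡3+a)) = m≢1+n+m _ a≡3+a
cyclicSuc-no-3-cycle 3≤2 (inj₁ (_ , refl)) (inj₁ (_ , refl)) (inj₂ (refl , refl)) = contradiction 3≤2 λ { (s≤s (s≤s ())) }
cyclicSuc-no-3-cycle 3≤2 (inj₁ (_ , refl)) (inj₂ (refl , refl)) (inj₁ (_ , refl)) = contradiction 3≤2 λ { (s≤s (s≤s ())) }
cyclicSuc-no-3-cycle 3≤2 (inj₂ (refl , refl)) (inj₁ (_ , refl)) (inj₁ (_ , refl)) = contradiction 3≤2 λ { (s≤s (s≤s ())) }
cyclicSuc-no-3-cycle _ (inj₁ (_ , refl)) (inj₂ (refl , refl)) (inj₂ (() , _))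
cyclicSuc-no-3-cycle 3≤M (inj₂ (_ , refl)) (inj₂ (0≡M , _)) _ = contradiction (subst (3 ≤_) (sym 0≡M) 3≤M) λ ()
cyclicSuc-no-3-cycle _ (inj₂ (refl , refl)) (inj₁ (_ , refl)) (inj₂ (refl , ()))

pattern 0F = zero
pattern 1F = suc zero
pattern 2F = suc (suc zero)

infix 10 _⁺

_⁺ : ∀ {m} → Fin m → Fin m
x ⁺ = sucMod x

⁺-injective : ∀ {M} → Injective _≡_ _≡_ (_⁺ {suc M})
⁺-injective {M} {x} {y} x⁺≡y⁺ =
  toℕ-injective (cyclicSuc-injective (toℕ-sucMod x) (subst (CyclicSuc M (toℕ y) ∘ toℕ) (sym x⁺≡y⁺) (toℕ-sucMod y)))

⁺-irreflexive : ∀ {M} → 1 ≤ M → (x : Fin (suc M)) → x ⁺ ≢ x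
⁺-irreflexive 1≤M x x⁺≡x with toℕ-sucMod x
... | inj₁ (_ , x⁺≡1+x) = 1+n≢n (trans (sym x⁺≡1+x) (cong toℕ x⁺≡x))
... | inj₂ (x≡M , x⁺≡0) with subst (1 ≤_) (trans (sym x≡M) (trans (cong toℕ (sym x⁺≡x)) x⁺≡0)) 1≤M
...   | ()

⁺-induction : ∀ {M} (P : Fin (suc M) → Set) → P zero → (∀ i → P i → P (i ⁺)) → ∀ i → P i
⁺-induction {M} P P₀ step = <-weakInduction P P₀ (λ i P[i] → subst P (inject₁-⁺ i) (step _ P[i]))
  where
  inject₁-⁺ : ∀ i → inject₁ i ⁺ ≡ suc i
  inject₁-⁺ i with toℕ-sucMod (inject₁ i)
  ... | inj₁ (_ , i⁺≡1+i) = toℕ-injective (trans i⁺≡1+i (cong suc (toℕ-inject₁ i)))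
  ... | inj₂ (i≡M , _) = contradiction (subst (_< M) (trans (sym (toℕ-inject₁ i)) i≡M) (toℕ<n i)) (n≮n M)

χ : ∀ {A : Set} → Dec A → Parity
χ a? = if does a? then 1ℙ else 0ℙ

χ-yes : ∀ {A : Set} (a? : Dec A) → A → χ a? ≡ 1ℙ
χ-yes a? a = cong (if_then 1ℙ else 0ℙ) (dec-true a? a)

χ-no : ∀ {A : Set} (a? : Dec A) → ¬ A → χ a? ≡ 0ℙ
χ-no a? ¬a = cong (if_then 1ℙ else 0ℙ) (dec-false a? ¬a)

χ-⇔ : ∀ {A B : Set} → (A → B) → (B → A) → (a? : Dec A) (b? : Dec B) → χ a? ≡ χ b?
χ-⇔ A→B B→A a? b? = cong (if_then 1ℙ else 0ℙ) (does-⇔ (mk⇔ A→B B→A) a? b?)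

∑-1ℙ : ∀ n → ∑[ i < n ] 1ℙ ≡ parity n
∑-1ℙ zero = refl
∑-1ℙ (suc n) = trans (cong (1ℙ +_) (∑-1ℙ n)) (⁻¹-selfInverse (suc-homo-⁻¹ n))

∑-indicator : ∀ {n} (i₀ : Fin n) → ∑[ i < n ] χ (i ≟ᶠ i₀) ≡ 1ℙ
∑-indicator {suc n} zero = cong (1ℙ +_) (sum-replicate-zero n)
∑-indicator {suc n} (suc i₀) = ∑-indicator i₀

∑-telescope : ∀ {M} (f : Fin (suc M) → Parity) → ∑[ i < suc M ] (f i + f (i ⁺)) ≡ 0ℙ
∑-telescope {M} f = begin
  ∑[ i < suc M ] (f i + f (i ⁺))               ≡⟨ ∑-distrib-+ f (f ∘ _⁺) ⟩
  ∑[ i < suc M ] f i + ∑[ i < suc M ] f (i ⁺)  ≡⟨ cong (∑[ i < suc M ] f i +_) (∑-permute f rotation) ⟨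
  ∑[ i < suc M ] f i + ∑[ i < suc M ] f i      ≡⟨ p+p≡0ℙ (∑[ i < suc M ] f i) ⟩
  0ℙ                                           ∎
  where
  open ≡-Reasoning
  rotation = injective⇒permutation _⁺ ⁺-injective

parity-even : ∀ {n} → 2 ∣ n → parity n ≡ 0ℙ
parity-even (divides q refl) = trans (*-homo-* q 2) (*-zeroʳ (parity q))

infix 9 _<ℙ_

_<ℙ_ : ℕ → ℕ → Parity
a <ℙ b = χ (a <? b)

<⇒<ℙ≡1ℙ : ∀ {a b} → a < b → a <ℙ b ≡ 1ℙ
<⇒<ℙ≡1ℙ {a} {b} = χ-yes (a <? b)

>⇒<ℙ≡0ℙ : ∀ {a b} → b < a → a <ℙ b ≡ 0ℙ
>⇒<ℙ≡0ℙ {a} {b} b<a = χ-no (a <? b) (<⇒≯ b<a)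

<ℙ-flip : ∀ {a b} → a ≢ b → a <ℙ b ≡ b <ℙ a ⁻¹
<ℙ-flip {a} {b} a≢b with <-cmp a b
... | tri< a<b _ _ = trans (<⇒<ℙ≡1ℙ a<b) (cong _⁻¹ (sym (>⇒<ℙ≡0ℙ a<b)))
... | tri≈ _ a≡b _ = contradiction a≡b a≢b
... | tri> _ _ b<a = trans (>⇒<ℙ≡0ℙ b<a) (cong _⁻¹ (sym (<⇒<ℙ≡1ℙ b<a)))

<ℙ-suc : ∀ {p u} → u ≢ suc p → suc p <ℙ u ≡ p <ℙ u
<ℙ-suc {p} {u} u≢1+p = χ-⇔ (≤-trans (n≤1+n _)) (λ p<u → ≤∧≢⇒< p<u (u≢1+p ∘ sym)) (suc p <? u) (p <? u)

inversions : ℕ → ℕ → ℕ → Parity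
inversions a b c = b <ℙ a + c <ℙ a + c <ℙ b

inversions-swap₁₂ : ∀ {a b} c → a ≢ b → inversions b a c ≡ inversions a b c ⁻¹
inversions-swap₁₂ {a} {b} c a≢b =
  trans (cong (λ x → x + c <ℙ b + c <ℙ a) (<ℙ-flip a≢b)) (shuffle (b <ℙ a) (c <ℙ b) (c <ℙ a))
  where
  -- x ⁻¹ computes to 1ℙ + x, so this is an identity of commutative monoids
  shuffle : ∀ x y z → x ⁻¹ + y + z ≡ (x + z + y) ⁻¹
  shuffle = solve 4 (λ o x y z → ((o ⊕ x) ⊕ y) ⊕ z ⊜ o ⊕ ((x ⊕ z) ⊕ y)) refl 1ℙ

inversions-swap₂₃ : ∀ a {b c} → b ≢ c → inversions a c b ≡ inversions a b c ⁻¹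
inversions-swap₂₃ a {b} {c} b≢c =
  trans (cong (c <ℙ a + b <ℙ a +_) (<ℙ-flip b≢c)) (shuffle (b <ℙ a) (c <ℙ a) (c <ℙ b))
  where
  shuffle : ∀ x y z → y + x + z ⁻¹ ≡ (x + y + z) ⁻¹
  shuffle = solve 4 (λ o x y z → (y ⊕ x) ⊕ (o ⊕ z) ⊜ o ⊕ ((x ⊕ y) ⊕ z)) refl 1ℙ

-- For three distinct values an even number of inversions means that they are in cyclic order,
-- which a rotation of ℤ/(M + 1) preserves.
inversions-cyclicSuc : ∀ {M a b c a′ b′ c′} → a ≢ b → a ≢ c → b ≢ c →
  CyclicSuc M a a′ → CyclicSuc M b b′ → CyclicSuc M c c′ → inversions a′ b′ c′ ≡ inversions a b c
inversions-cyclicSuc _ _ _ (inj₁ (_ , refl)) (inj₁ (_ , refl)) (inj₁ (_ , refl)) = refl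
inversions-cyclicSuc {b = b} {c} _ _ _ (inj₂ (refl , refl)) (inj₁ (b<M , refl)) (inj₁ (c<M , refl)) =
  sym (cong₂ (λ x y → x + y + c <ℙ b) (<⇒<ℙ≡1ℙ b<M) (<⇒<ℙ≡1ℙ c<M))
inversions-cyclicSuc {a = a} {c = c} _ _ _ (inj₁ (a<M , refl)) (inj₂ (refl , refl)) (inj₁ (c<M , refl)) =
  trans (shuffle (c <ℙ a)) (sym (cong₂ (λ x y → x + c <ℙ a + y) (>⇒<ℙ≡0ℙ a<M) (<⇒<ℙ≡1ℙ c<M)))
  where
  shuffle : ∀ x → 1ℙ + x + 0ℙ ≡ 0ℙ + x + 1ℙ
  shuffle 0ℙ = refl
  shuffle 1ℙ = refl
inversions-cyclicSuc {a = a} {b} _ _ _ (inj₁ (a<M , refl)) (inj₁ (b<M , refl)) (inj₂ (refl , refl)) =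
  trans (shuffle (b <ℙ a)) (sym (cong₂ (λ x y → b <ℙ a + x + y) (>⇒<ℙ≡0ℙ a<M) (>⇒<ℙ≡0ℙ b<M)))
  where
  shuffle : ∀ x → x + 1ℙ + 1ℙ ≡ x + 0ℙ + 0ℙ
  shuffle 0ℙ = refl
  shuffle 1ℙ = refl
inversions-cyclicSuc a≢b _ _ (inj₂ (a≡M , _)) (inj₂ (b≡M , _)) _ = contradiction (trans a≡M (sym b≡M)) a≢b
inversions-cyclicSuc _ a≢c _ (inj₂ (a≡M , _)) _ (inj₂ (c≡M , _)) = contradiction (trans a≡M (sym c≡M)) a≢c
inversions-cyclicSuc _ _ b≢c _ (inj₂ (b≡M , _)) (inj₂ (c≡M , _)) = contradiction (trans b≡M (sym c≡M)) b≢c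

inversions-permute : ∀ (w : Fin 3 → ℕ) → Injective _≡_ _≡_ w → ∀ {s₀ s₁ s₂} → s₀ ≢ s₁ → s₀ ≢ s₂ → s₁ ≢ s₂ →
  inversions (w s₀) (w s₁) (w s₂) ≡ inversions (w 0F) (w 1F) (w 2F) + inversions (toℕ s₀) (toℕ s₁) (toℕ s₂)
inversions-permute w w-inj {0F} {1F} {2F} _ _ _ = sym (+-identityʳ _)
inversions-permute w w-inj {1F} {0F} {2F} _ _ _ =
  trans (inversions-swap₁₂ (w 2F) (injective⇒≢ w-inj λ ())) (+-comm 1ℙ _)
inversions-permute w w-inj {0F} {2F} {1F} _ _ _ =
  trans (inversions-swap₂₃ (w 0F) (injective⇒≢ w-inj λ ())) (+-comm 1ℙ _)
inversions-permute w w-inj {1F} {2F} {0F} _ _ _ = begin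
  inversions (w 1F) (w 2F) (w 0F)        ≡⟨ inversions-swap₂₃ (w 1F) (injective⇒≢ w-inj λ ()) ⟩
  inversions (w 1F) (w 0F) (w 2F) ⁻¹     ≡⟨ cong _⁻¹ (inversions-swap₁₂ (w 2F) (injective⇒≢ w-inj λ ())) ⟩
  inversions (w 0F) (w 1F) (w 2F) ⁻¹ ⁻¹  ≡⟨ ⁻¹-involutive _ ⟩
  inversions (w 0F) (w 1F) (w 2F)        ≡⟨ +-identityʳ _ ⟨
  inversions (w 0F) (w 1F) (w 2F) + 0ℙ   ∎
  where open ≡-Reasoning
inversions-permute w w-inj {2F} {0F} {1F} _ _ _ = begin
  inversions (w 2F) (w 0F) (w 1F)        ≡⟨ inversions-swap₁₂ (w 1F) (injective⇒≢ w-inj λ ()) ⟩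
  inversions (w 0F) (w 2F) (w 1F) ⁻¹     ≡⟨ cong _⁻¹ (inversions-swap₂₃ (w 0F) (injective⇒≢ w-inj λ ())) ⟩
  inversions (w 0F) (w 1F) (w 2F) ⁻¹ ⁻¹  ≡⟨ ⁻¹-involutive _ ⟩
  inversions (w 0F) (w 1F) (w 2F)        ≡⟨ +-identityʳ _ ⟨
  inversions (w 0F) (w 1F) (w 2F) + 0ℙ   ∎
  where open ≡-Reasoning
inversions-permute w w-inj {2F} {1F} {0F} _ _ _ = begin
  inversions (w 2F) (w 1F) (w 0F)              ≡⟨ inversions-swap₁₂ (w 0F) (injective⇒≢ w-inj λ ()) ⟩
  inversions (w 1F) (w 2F) (w 0F) ⁻¹           ≡⟨ cong _⁻¹ (inversions-permute w w-inj {1F} {2F} {0F} (λ ()) (λ ()) (λ ())) ⟩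
  (inversions (w 0F) (w 1F) (w 2F) + 0ℙ) ⁻¹    ≡⟨ cong _⁻¹ (+-identityʳ _) ⟩
  inversions (w 0F) (w 1F) (w 2F) ⁻¹           ≡⟨ +-comm 1ℙ _ ⟩
  inversions (w 0F) (w 1F) (w 2F) + 1ℙ         ∎
  where open ≡-Reasoning
inversions-permute _ _ {0F} {0F} s₀≢s₁ _ _ = contradiction refl s₀≢s₁
inversions-permute _ _ {1F} {1F} s₀≢s₁ _ _ = contradiction refl s₀≢s₁
inversions-permute _ _ {2F} {2F} s₀≢s₁ _ _ = contradiction refl s₀≢s₁
inversions-permute _ _ {0F} {_} {0F} _ s₀≢s₂ _ = contradiction refl s₀≢s₂
inversions-permute _ _ {1F} {_} {1F} _ s₀≢s₂ _ = contradiction refl s₀≢s₂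
inversions-permute _ _ {2F} {_} {2F} _ s₀≢s₂ _ = contradiction refl s₀≢s₂
inversions-permute _ _ {_} {0F} {0F} _ _ s₁≢s₂ = contradiction refl s₁≢s₂
inversions-permute _ _ {_} {1F} {1F} _ _ s₁≢s₂ = contradiction refl s₁≢s₂
inversions-permute _ _ {_} {2F} {2F} _ _ s₁≢s₂ = contradiction refl s₁≢s₂

atEnd? : ∀ M p p₁ u → Dec (p ≡ M ⊎ p₁ ≡ M ⊎ u ≡ M)
atEnd? M p p₁ u = (p ≟ⁿ M) ⊎-dec (p₁ ≟ⁿ M) ⊎-dec (u ≟ⁿ M)

-- Two strands of a cycle crossing a layer: one at times p and p₁ and next at p₂, the other at time u
-- and next at u₁. Their order in time flips exactly when one of them passes the last time M.
strand-order : ∀ {M p p₁ p₂ u u₁} → 1 ≤ M → CyclicSuc M p p₁ → CyclicSuc M p₁ p₂ → CyclicSuc M u u₁ →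
  u ≢ p → u ≢ p₁ → p₂ <ℙ u₁ ≡ p <ℙ u + χ (atEnd? M p p₁ u)
strand-order {M} {p} {u = u} _ (inj₁ (p<M , refl)) (inj₁ (1+p<M , refl)) (inj₁ (u<M , refl)) _ u≢1+p =
  trans (<ℙ-suc u≢1+p) (sym (trans (cong (p <ℙ u +_) (χ-no (atEnd? M p (suc p) u) none)) (+-identityʳ _)))
  where
  none : ¬ (p ≡ M ⊎ suc p ≡ M ⊎ u ≡ M)
  none (inj₁ p≡M) = <⇒≢ p<M p≡M
  none (inj₂ (inj₁ 1+p≡M)) = <⇒≢ 1+p<M 1+p≡M
  none (inj₂ (inj₂ u≡M)) = <⇒≢ u<M u≡M
strand-order {p = p} {u = u} _ (inj₁ (_ , refl)) (inj₂ (refl , refl)) (inj₁ (u<M , refl)) u≢p _ =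
  sym (cong₂ _+_ (>⇒<ℙ≡0ℙ (≤∧≢⇒< (≤-pred u<M) u≢p)) (χ-yes (atEnd? (suc p) p (suc p) u) (inj₂ (inj₁ refl))))
strand-order {p = p} {u = u} _ (inj₁ (p<M , refl)) (inj₁ (_ , refl)) (inj₂ (refl , refl)) _ _ =
  sym (cong₂ _+_ (<⇒<ℙ≡1ℙ p<M) (χ-yes (atEnd? u p (suc p) u) (inj₂ (inj₂ refl))))
strand-order {p = p} {u = u} _ (inj₂ (refl , refl)) (inj₁ (_ , refl)) (inj₁ (u<M , refl)) _ u≢0 =
  trans (<⇒<ℙ≡1ℙ (≤∧≢⇒< z≤n (u≢0 ∘ sym))) (sym (cong₂ _+_ (>⇒<ℙ≡0ℙ u<M) (χ-yes (atEnd? p p 0 u) (inj₁ refl))))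
strand-order 1≤M (inj₂ (_ , refl)) (inj₂ (0≡M , _)) _ _ _ = contradiction (subst (1 ≤_) (sym 0≡M) 1≤M) λ ()
strand-order _ (inj₂ (p≡M , _)) _ (inj₂ (u≡M , _)) u≢p _ = contradiction (trans u≡M (sym p≡M)) u≢p
strand-order _ _ (inj₂ (p₁≡M , _)) (inj₂ (u≡M , _)) _ u≢p₁ = contradiction (trans u≡M (sym p₁≡M)) u≢p₁

-- The arcs leaving a vertex (i , x) of Cₙ ≀ C₃: along leads to (i , x + 1), across y to (i + 1 , y).
Out : Set
Out = Fin 4

pattern along = zero
pattern across y = suc y

-- The arcs by which one cycle leaves the vertices (i , 0), (i , 1), (i , 2) of a layer.
Behaviour : Set
Behaviour = Vec Out 3

alongCount : Behaviour → ℕ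
alongCount = count (_≟ᶠ along)

-- Without along-arcs: the sign of the permutation of C₃ followed by the cycle
-- (toℕ (across y) = 1 + toℕ y does not change the inversions).
sign : Behaviour → Parity
sign b = inversions (toℕ (lookup b 0F)) (toℕ (lookup b 1F)) (toℕ (lookup b 2F))

-- With a single along-arc, at a, the cycle crosses the layer in two strands, one through a and a + 1
-- and one through a + 2; the twist records whether the strand leaving a + 2 lands right after the one
-- leaving a + 1, which is when the two strands exchange their roles in the next layer. The values for
-- two and for no along-arcs are those for which layer-facts holds.
twist : Behaviour → Parity
twist (along ∷ across p ∷ across q ∷ []) = χ (q ≟ᶠ p ⁺)
twist (across q ∷ along ∷ across p ∷ []) = χ (q ≟ᶠ p ⁺)
twist (across p ∷ across q ∷ along ∷ []) = χ (q ≟ᶠ p ⁺)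
twist (along ∷ along ∷ across _ ∷ []) = 1ℙ
twist (along ∷ across _ ∷ along ∷ []) = 1ℙ
twist (across _ ∷ along ∷ along ∷ []) = 1ℙ
twist _ = 0ℙ

AcrossInjective : Behaviour → Set
AcrossInjective b = ∀ x y → lookup b x ≡ lookup b y → x ≡ y ⊎ lookup b x ≡ along

AllAlong : Behaviour → Set
AllAlong b = ∀ x → lookup b x ≡ along

Enters : Behaviour → Fin 3 → Set
Enters b y = ∃ λ x → lookup b x ≡ across y

-- b′ is the behaviour of the same cycle in the next layer: a vertex (i + 1 , y + 1) that is not
-- entered from layer i must be entered along the arc from (i + 1 , y).
Follows : Behaviour → Behaviour → Set
Follows b b′ = ∀ y → (lookup b′ y ≡ along → ¬ Enters b (y ⁺)) × (¬ Enters b (y ⁺) → lookup b′ y ≡ along)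

Strands : Behaviour → Fin 3 → Fin 3 → Set
Strands b a a′ =
  (lookup b (a ⁺) ≡ across a′ × lookup b (a ⁺ ⁺) ≡ across (a′ ⁺ ⁺) × twist b ≡ 0ℙ) ⊎
  (lookup b (a ⁺) ≡ across (a′ ⁺ ⁺) × lookup b (a ⁺ ⁺) ≡ across a′ × twist b ≡ 1ℙ)

Distinct : ∀ {m} → Vec Out m → Set
Distinct u = ∀ d d′ → lookup u d ≡ lookup u d′ → d ≡ d′

-- The four cycles through a layer, each named by the arc d by which it leaves (i , 0); it leaves
-- (i , 1) by lookup u d and (i , 2) by lookup v d.
row : Vec Out 4 → Vec Out 4 → Out → Behaviour
row u v d = d ∷ lookup u d ∷ lookup v d ∷ []

record ValidLayer (u v : Vec Out 4) : Set where
  field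
    distinct₁ : Distinct u
    distinct₂ : Distinct v
    rowsValid : ∀ d → AcrossInjective (row u v d) × ¬ AllAlong (row u v d)

-- Data.Fin.Properties.all? goes through subsets and evaluates far more slowly.
all-Fin? : ∀ {n} {P : Fin n → Set} → (∀ x → Dec (P x)) → Dec (∀ x → P x)
all-Fin? {zero} P? = yes λ ()
all-Fin? {suc n} P? = map′ (λ (p₀ , p) → λ { zero → p₀ ; (suc x) → p x }) (λ p → p zero , p ∘ suc)
                           (P? zero ×-dec all-Fin? (P? ∘ suc))

all-Vec? : ∀ {m} n {P : Vec (Fin m) n → Set} → (∀ v → Dec (P v)) → Dec (∀ v → P v)
all-Vec? zero P? = map′ (λ p → λ { [] → p }) (λ p → p []) (P? [])
all-Vec? (suc n) P? = map′ (λ p → λ { (x ∷ xs) → p x xs }) (λ p x xs → p (x ∷ xs))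
                           (all-Fin? λ x → all-Vec? n λ xs → P? (x ∷ xs))

acrossInjective? : ∀ b → Dec (AcrossInjective b)
acrossInjective? b =
  all-Fin? λ x → all-Fin? λ y → (lookup b x ≟ᶠ lookup b y) →-dec ((x ≟ᶠ y) ⊎-dec (lookup b x ≟ᶠ along))

allAlong? : ∀ b → Dec (AllAlong b)
allAlong? b = all-Fin? λ x → lookup b x ≟ᶠ along

enters? : ∀ b y → Dec (Enters b y)
enters? b y = any? λ x → lookup b x ≟ᶠ across y

follows? : ∀ b b′ → Dec (Follows b b′)
follows? b b′ = all-Fin? λ y →
  ((lookup b′ y ≟ᶠ along) →-dec ¬? (enters? b (y ⁺))) ×-dec (¬? (enters? b (y ⁺)) →-dec (lookup b′ y ≟ᶠ along))

distinct? : ∀ {m} (u : Vec Out m) → Dec (Distinct u)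
distinct? u = all-Fin? λ d → all-Fin? λ d′ → (lookup u d ≟ᶠ lookup u d′) →-dec (d ≟ᶠ d′)

all-validLayers? : ∀ {P : Vec Out 4 → Vec Out 4 → Set} → (∀ u v → Dec (P u v)) → Dec (∀ u v → ValidLayer u v → P u v)
all-validLayers? P? =
  map′ (λ p u v L → let open ValidLayer L in p u distinct₁ v distinct₂ rowsValid)
       (λ p u u-distinct v v-distinct rows → p u v (record { distinct₁ = u-distinct ; distinct₂ = v-distinct ; rowsValid = rows }))
       (all-Vec? 4 λ u → distinct? u →-dec all-Vec? 4 λ v → distinct? v →-dec
          (all-Fin? λ d → acrossInjective? (row u v d) ×-dec ¬? (allAlong? (row u v d))) →-dec P? u v)

-- Finite checks, decided by evaluation. They are opaque so that type checking never unfolds them again.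
opaque
  layer-facts : ∀ u v → ValidLayer u v →
    (∃ λ d → alongCount (row u v d) ≡ 0) ×
    ∑[ d < 4 ] parity (alongCount (row u v d)) ≡ 1ℙ ×
    (∀ d → alongCount (row u v d) ≡ 0 → sign (row u v d) ≡ ∑[ d′ < 4 ] twist (row u v d′))
  layer-facts = from-yes (all-validLayers? λ u v →
    (any? λ d → alongCount (row u v d) ≟ⁿ 0) ×-dec
    (∑[ d < 4 ] parity (alongCount (row u v d)) ≟ℙ 1ℙ) ×-dec
    (all-Fin? λ d → (alongCount (row u v d) ≟ⁿ 0) →-dec (sign (row u v d) ≟ℙ ∑[ d′ < 4 ] twist (row u v d′))))

  alongCount-cases : ∀ b → ¬ AllAlong b → alongCount b ≡ 0 ⊎ alongCount b ≡ 1 ⊎ alongCount b ≡ 2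
  alongCount-cases = from-yes (all-Vec? 3 λ b →
    ¬? (allAlong? b) →-dec ((alongCount b ≟ⁿ 0) ⊎-dec (alongCount b ≟ⁿ 1) ⊎-dec (alongCount b ≟ⁿ 2)))

  twist-crossing : ∀ b → alongCount b ≡ 0 → twist b ≡ 0ℙ
  twist-crossing = from-yes (all-Vec? 3 λ b → (alongCount b ≟ⁿ 0) →-dec (twist b ≟ℙ 0ℙ))

  twist-double : ∀ b → alongCount b ≡ 2 → twist b ≡ 1ℙ
  twist-double = from-yes (all-Vec? 3 λ b → (alongCount b ≟ⁿ 2) →-dec (twist b ≟ℙ 1ℙ))

  crossing-across : ∀ b → alongCount b ≡ 0 → ∀ x → ∃ λ y → lookup b x ≡ across y
  crossing-across = from-yes (all-Vec? 3 λ b → (alongCount b ≟ⁿ 0) →-dec all-Fin? λ x → any? λ y → lookup b x ≟ᶠ across y)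

  single-along : ∀ b → alongCount b ≡ 1 → ∃ λ a → lookup b a ≡ along
  single-along = from-yes (all-Vec? 3 λ b → (alongCount b ≟ⁿ 1) →-dec any? λ a → lookup b a ≟ᶠ along)

  alongCount-follows : ∀ b b′ → AcrossInjective b → Follows b b′ → alongCount b′ ≡ alongCount b
  alongCount-follows = from-yes (all-Vec? 3 λ b → all-Vec? 3 λ b′ →
    acrossInjective? b →-dec follows? b b′ →-dec (alongCount b′ ≟ⁿ alongCount b))

  strands : ∀ b b′ → AcrossInjective b → Follows b b′ → alongCount b ≡ 1 →
    ∀ a a′ → lookup b a ≡ along → lookup b′ a′ ≡ along → Strands b a a′
  strands = from-yes (all-Vec? 3 λ b → all-Vec? 3 λ b′ →
    acrossInjective? b →-dec follows? b b′ →-dec (alongCount b ≟ⁿ 1) →-dec all-Fin? λ a → all-Fin? λ a′ →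
    (lookup b a ≟ᶠ along) →-dec (lookup b′ a′ ≟ᶠ along) →-dec
    (((lookup b (a ⁺) ≟ᶠ across a′) ×-dec (lookup b (a ⁺ ⁺) ≟ᶠ across (a′ ⁺ ⁺)) ×-dec (twist b ≟ℙ 0ℙ)) ⊎-dec
     ((lookup b (a ⁺) ≟ᶠ across (a′ ⁺ ⁺)) ×-dec (lookup b (a ⁺ ⁺) ≟ᶠ across a′) ×-dec (twist b ≟ℙ 1ℙ))))

  ⁺⁺≢id : ∀ (a : Fin 3) → a ⁺ ⁺ ≢ a
  ⁺⁺≢id = from-yes (all-Fin? {3} λ a → ¬? (a ⁺ ⁺ ≟ᶠ a))

  ⁺⁺≢⁺ : ∀ (a : Fin 3) → a ⁺ ⁺ ≢ a ⁺
  ⁺⁺≢⁺ = from-yes (all-Fin? {3} λ a → ¬? (a ⁺ ⁺ ≟ᶠ a ⁺))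

  ⁺-cover : ∀ (a x : Fin 3) → x ≡ a ⊎ x ≡ a ⁺ ⊎ x ≡ a ⁺ ⁺
  ⁺-cover = from-yes (all-Fin? {3} λ a → all-Fin? {3} λ x → (x ≟ᶠ a) ⊎-dec (x ≟ᶠ a ⁺) ⊎-dec (x ≟ᶠ a ⁺ ⁺))

crossing-exists : ∀ u v → ValidLayer u v → ∃ λ d → alongCount (row u v d) ≡ 0
crossing-exists u v L = proj₁ (layer-facts u v L)

alongCount-parity-sum : ∀ u v → ValidLayer u v → ∑[ d < 4 ] parity (alongCount (row u v d)) ≡ 1ℙ
alongCount-parity-sum u v L = proj₁ (proj₂ (layer-facts u v L))

layer-sign≡∑twist : ∀ u v → ValidLayer u v → ∀ d → alongCount (row u v d) ≡ 0 →
  sign (row u v d) ≡ ∑[ d′ < 4 ] twist (row u v d′)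
layer-sign≡∑twist u v L = proj₂ (proj₂ (layer-facts u v L))

module Wreath (k : ℕ) where

  n : ℕ
  n = suc (suc k)

  G : Digraph
  G = wreath (dcycle n) (dcycle 3)

  V : Set
  V = Fin (n * 3)

  -- the times along a hamiltonian cycle of G are 0, …, M
  M : ℕ
  M = pred (n * 3)

  LayerArc : Fin n × Fin 3 → Fin n × Fin 3 → Set
  LayerArc (i , x) (j , y) = i ⁺ ≡ j ⊎ (i ≡ j × x ⁺ ≡ y)

  -- opaque: unfolding combine during unification makes type checking very slow
  opaque
    vertex : Fin n → Fin 3 → V
    vertex = combine

    vertex-injective : ∀ i x j y → vertex i x ≡ vertex j y → i ≡ j × x ≡ y
    vertex-injective = combine-injective

    vertex-surjective : ∀ v → ∃ λ i → ∃ λ x → vertex i x ≡ v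
    vertex-surjective = combine-surjective

    arc⇒layerArc : ∀ i x j y → Arc G (vertex i x) (vertex j y) → LayerArc (i , x) (j , y)
    arc⇒layerArc i x j y = subst₂ LayerArc (remQuot-combine i x) (remQuot-combine j y)

    layerArc⇒arc : ∀ i x j y → LayerArc (i , x) (j , y) → Arc G (vertex i x) (vertex j y)
    layerArc⇒arc i x j y = subst₂ LayerArc (sym (remQuot-combine i x)) (sym (remQuot-combine j y))

  ⁺≢id : ∀ (i : Fin n) → i ⁺ ≢ i
  ⁺≢id = ⁺-irreflexive (s≤s z≤n)

  target : Fin n → Fin 3 → Out → V
  target i x along = vertex i (x ⁺)
  target i x (across y) = vertex (i ⁺) y

  target-injective : ∀ i x → Injective _≡_ _≡_ (target i x)
  target-injective i x {along} {along} _ = refl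
  target-injective i x {across y} {across y′} e = cong across (proj₂ (vertex-injective (i ⁺) y (i ⁺) y′ e))
  target-injective i x {along} {across y} e = contradiction (sym (proj₁ (vertex-injective i (x ⁺) (i ⁺) y e))) (⁺≢id i)
  target-injective i x {across y} {along} e = contradiction (proj₁ (vertex-injective (i ⁺) y i (x ⁺) e)) (⁺≢id i)

  arc-target : ∀ i x o → Arc G (vertex i x) (target i x o)
  arc-target i x along = layerArc⇒arc i x i (x ⁺) (inj₂ (refl , refl))
  arc-target i x (across y) = layerArc⇒arc i x (i ⁺) y (inj₁ refl)

  target-of-arc : ∀ i x w → Arc G (vertex i x) w → ∃ λ o → w ≡ target i x o
  target-of-arc i x w arc with vertex-surjective w
  ... | j , y , refl with arc⇒layerArc i x j y arc
  ...   | inj₁ refl = across y , refl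
  ...   | inj₂ (refl , refl) = along , refl

  module Cycle (H : HamCycle G) where

    opaque
      order : Permutation′ (n * 3)
      order = injective⇒permutation (c H) (inj H)

      position : V → Fin (n * 3)
      position v = order ⟨$⟩ˡ v

      position-c : ∀ p → position (c H p) ≡ p
      position-c p = inverseˡ order

      c-position : ∀ v → c H (position v) ≡ v
      c-position v = inverseʳ order

    next : V → V
    next v = c H (position v ⁺)

    position-injective : Injective _≡_ _≡_ position
    position-injective {v} {w} e = trans (sym (c-position v)) (trans (cong (c H) e) (c-position w))

    arc-next : ∀ v → Arc G v (next v)
    arc-next v = subst (λ u → Arc G u (next v)) (c-position v) (arcs H (position v))

    next-injective : Injective _≡_ _≡_ next
    next-injective e = position-injective (⁺-injective (inj H e))

    uses⇒next : ∀ {u w} → UsesArc H u w → next u ≡ w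
    uses⇒next (p , refl , refl) = cong (λ q → c H (q ⁺)) (position-c p)

    next⇒uses : ∀ {u w} → next u ≡ w → UsesArc H u w
    next⇒uses e = position _ , c-position _ , e

    predecessor : ∀ w → ∃ λ j → ∃ λ z → next (vertex j z) ≡ w
    predecessor w =
      let u , next-u = injective⇒surjective next next-injective w
          j , z , vertex-jz = vertex-surjective u
      in j , z , trans (cong next vertex-jz) next-u

    opaque
      move : Fin n → Fin 3 → Out
      move i x = proj₁ (target-of-arc i x (next (vertex i x)) (arc-next (vertex i x)))

      next-vertex : ∀ i x → next (vertex i x) ≡ target i x (move i x)
      next-vertex i x = proj₂ (target-of-arc i x (next (vertex i x)) (arc-next (vertex i x)))

    move-unique : ∀ {i x o} → next (vertex i x) ≡ target i x o → move i x ≡ o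
    move-unique {i} {x} e = target-injective i x (trans (sym (next-vertex i x)) e)

    behaviour : Fin n → Behaviour
    behaviour i = tabulate (move i)

    lookup-behaviour : ∀ i x → lookup (behaviour i) x ≡ move i x
    lookup-behaviour i = lookup∘tabulate (move i)

    time : Fin n → Fin 3 → ℕ
    time i x = toℕ (position (vertex i x))

    time-injective : ∀ i → Injective _≡_ _≡_ (time i)
    time-injective i {x} {y} e = proj₂ (vertex-injective i x i y (position-injective (toℕ-injective e)))

    time-next : ∀ {i x j y} → next (vertex i x) ≡ vertex j y → CyclicSuc M (time i x) (time j y)
    time-next {i} {x} e = subst (λ w → CyclicSuc M (time i x) (toℕ (position w))) e
      (subst (CyclicSuc M (time i x) ∘ toℕ) (sym (position-c (position (vertex i x) ⁺))) (toℕ-sucMod (position (vertex i x))))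

    time-along : ∀ {i x} → move i x ≡ along → CyclicSuc M (time i x) (time i (x ⁺))
    time-along {i} {x} e = time-next (trans (next-vertex i x) (cong (target i x) e))

    time-across : ∀ {i x y} → move i x ≡ across y → CyclicSuc M (time i x) (time (i ⁺) y)
    time-across {i} {x} e = time-next (trans (next-vertex i x) (cong (target i x) e))

    move-acrossInjective : ∀ i x y → move i x ≡ move i y → x ≡ y ⊎ move i x ≡ along
    move-acrossInjective i x y e with move i x in mx
    ... | along = inj₂ refl
    ... | across z = inj₁ (proj₂ (vertex-injective i x i y (next-injective (trans next-x (sym next-y)))))
      where
      next-x : next (vertex i x) ≡ vertex (i ⁺) z
      next-x = trans (next-vertex i x) (cong (target i x) mx)
      next-y : next (vertex i y) ≡ vertex (i ⁺) z
      next-y = trans (next-vertex i y) (cong (target i y) (sym e))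

    behaviour-acrossInjective : ∀ i → AcrossInjective (behaviour i)
    behaviour-acrossInjective i x y rewrite lookup-behaviour i x | lookup-behaviour i y = move-acrossInjective i x y

    behaviour-notAllAlong : ∀ i → ¬ AllAlong (behaviour i)
    behaviour-notAllAlong i allAlong =
      cyclicSuc-no-3-cycle (s≤s (s≤s (s≤s z≤n))) (time-along (along-at 0F)) (time-along (along-at 1F)) (time-along (along-at 2F))
      where
      along-at : ∀ x → move i x ≡ along
      along-at x = trans (sym (lookup-behaviour i x)) (allAlong x)

    entered-once : ∀ i y → move (i ⁺) y ≡ along → ¬ Enters (behaviour i) (y ⁺)
    entered-once i y e (x , bx) = ⁺≢id i (proj₁ (vertex-injective (i ⁺) y i x (next-injective (trans next-y (sym next-x)))))
      where
      next-y : next (vertex (i ⁺) y) ≡ vertex (i ⁺) (y ⁺)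
      next-y = trans (next-vertex (i ⁺) y) (cong (target (i ⁺) y) e)
      next-x : next (vertex i x) ≡ vertex (i ⁺) (y ⁺)
      next-x = trans (next-vertex i x) (cong (target i x) (trans (sym (lookup-behaviour i x)) bx))

    entered : ∀ i y → move (i ⁺) y ≡ along ⊎ Enters (behaviour i) (y ⁺)
    entered i y = from-predecessor (predecessor (vertex (i ⁺) (y ⁺)))
      where
      from-predecessor : (∃ λ j → ∃ λ z → next (vertex j z) ≡ vertex (i ⁺) (y ⁺)) →
        move (i ⁺) y ≡ along ⊎ Enters (behaviour i) (y ⁺)
      from-predecessor (j , z , e) with move j z in mjz
      ... | along =
        let j≡i⁺ , z⁺≡y⁺ = vertex-injective j (z ⁺) (i ⁺) (y ⁺) (trans (sym (trans (next-vertex j z) (cong (target j z) mjz))) e)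
        in inj₁ (move-unique (subst₂ (λ j z → next (vertex j z) ≡ vertex (i ⁺) (y ⁺)) j≡i⁺ (⁺-injective z⁺≡y⁺) e))
      ... | across y′ =
        let j⁺≡i⁺ , _ = vertex-injective (j ⁺) y′ (i ⁺) (y ⁺) (trans (sym (trans (next-vertex j z) (cong (target j z) mjz))) e)
        in inj₂ (z , trans (lookup-behaviour i z) (move-unique (subst (λ j → next (vertex j z) ≡ vertex (i ⁺) (y ⁺)) (⁺-injective j⁺≡i⁺) e)))

    behaviour-follows : ∀ i → Follows (behaviour i) (behaviour (i ⁺))
    behaviour-follows i y =
      (λ b′y → entered-once i y (trans (sym (lookup-behaviour (i ⁺) y)) b′y)) ,
      (λ ¬entered → trans (lookup-behaviour (i ⁺) y) (fromInj₁ (λ e → contradiction e ¬entered) (entered i y)))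

    alongCount-constant : ∀ i → alongCount (behaviour i) ≡ alongCount (behaviour 0F)
    alongCount-constant = ⁺-induction _ refl λ i eq →
      trans (alongCount-follows _ _ (behaviour-acrossInjective i) (behaviour-follows i)) eq

    cyclicOrder : Fin n → Parity
    cyclicOrder i = inversions (time i 0F) (time i 1F) (time i 2F)

    sign-step : ∀ i → alongCount (behaviour i) ≡ 0 → sign (behaviour i) ≡ cyclicOrder i + cyclicOrder (i ⁺)
    sign-step i crossing = begin
      sign (behaviour i)                                  ≡⟨ cong₃ (λ a b c → inversions (toℕ a) (toℕ b) (toℕ c)) (move-σ 0F) (move-σ 1F) (move-σ 2F) ⟩
      inversions (toℕ (σ 0F)) (toℕ (σ 1F)) (toℕ (σ 2F))   ≡⟨ difference (trans (sym rotated) permuted) ⟩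
      cyclicOrder i + cyclicOrder (i ⁺)                   ∎
      where
      open ≡-Reasoning
      σ : Fin 3 → Fin 3
      σ x = proj₁ (crossing-across (behaviour i) crossing x)
      move-σ : ∀ x → move i x ≡ across (σ x)
      move-σ x = trans (sym (lookup-behaviour i x)) (proj₂ (crossing-across (behaviour i) crossing x))
      σ-injective : Injective _≡_ _≡_ σ
      σ-injective {x} {y} σx≡σy with move-acrossInjective i x y (trans (move-σ x) (trans (cong across σx≡σy) (sym (move-σ y))))
      ... | inj₁ x≡y = x≡y
      ... | inj₂ along≡ = contradiction (trans (sym along≡) (move-σ x)) λ ()
      rotated : inversions (time (i ⁺) (σ 0F)) (time (i ⁺) (σ 1F)) (time (i ⁺) (σ 2F)) ≡ cyclicOrder i
      rotated = inversions-cyclicSuc (injective⇒≢ (time-injective i) λ ()) (injective⇒≢ (time-injective i) λ ())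
                  (injective⇒≢ (time-injective i) λ ()) (time-across (move-σ 0F)) (time-across (move-σ 1F)) (time-across (move-σ 2F))
      permuted : inversions (time (i ⁺) (σ 0F)) (time (i ⁺) (σ 1F)) (time (i ⁺) (σ 2F))
               ≡ cyclicOrder (i ⁺) + inversions (toℕ (σ 0F)) (toℕ (σ 1F)) (toℕ (σ 2F))
      permuted = inversions-permute (time (i ⁺)) (time-injective (i ⁺))
                   (injective⇒≢ σ-injective λ ()) (injective⇒≢ σ-injective λ ()) (injective⇒≢ σ-injective λ ())
      difference : ∀ {x y s} → x ≡ y + s → s ≡ x + y
      difference {y = 0ℙ} {0ℙ} refl = refl
      difference {y = 0ℙ} {1ℙ} refl = refl
      difference {y = 1ℙ} {0ℙ} refl = refl
      difference {y = 1ℙ} {1ℙ} refl = refl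

    sign-sum : (∀ i → alongCount (behaviour i) ≡ 0) → ∑[ i < n ] sign (behaviour i) ≡ 0ℙ
    sign-sum crossing = trans (sum-cong-≗ (λ i → sign-step i (crossing i))) (∑-telescope cyclicOrder)

    lastVertex : V
    lastVertex = c H (fromℕ M)

    lastLayer : Fin n
    lastLayer = proj₁ (vertex-surjective lastVertex)

    lastIndex : Fin 3
    lastIndex = proj₁ (proj₂ (vertex-surjective lastVertex))

    time-last : time lastLayer lastIndex ≡ M
    time-last = trans (cong (toℕ ∘ position) (proj₂ (proj₂ (vertex-surjective lastVertex))))
                      (trans (cong toℕ (position-c (fromℕ M))) (toℕ-fromℕ M))

    time≡M⇒lastLayer : ∀ {i x} → time i x ≡ M → i ≡ lastLayer
    time≡M⇒lastLayer {i} {x} e = proj₁ (vertex-injective i x lastLayer lastIndex (begin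
      vertex i x                    ≡⟨ c-position (vertex i x) ⟨
      c H (position (vertex i x))   ≡⟨ cong (c H) (toℕ-injective (trans e (sym (toℕ-fromℕ M)))) ⟩
      lastVertex                    ≡⟨ proj₂ (proj₂ (vertex-surjective lastVertex)) ⟨
      vertex lastLayer lastIndex    ∎))
      where open ≡-Reasoning

    module SingleAlong (single : ∀ i → alongCount (behaviour i) ≡ 1) where

      a : Fin n → Fin 3
      a i = proj₁ (single-along (behaviour i) (single i))

      along-a : ∀ i → lookup (behaviour i) (a i) ≡ along
      along-a i = proj₂ (single-along (behaviour i) (single i))

      ahead : Fin n → Parity
      ahead i = time i (a i) <ℙ time i (a i ⁺ ⁺)

      wraps : Fin n → Parity
      wraps i = χ (atEnd? M (time i (a i)) (time i (a i ⁺)) (time i (a i ⁺ ⁺)))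

      twist-step : ∀ i → twist (behaviour i) ≡ ahead i + ahead (i ⁺) + wraps i
      twist-step i = from-strands (strands (behaviour i) (behaviour (i ⁺)) (behaviour-acrossInjective i)
                                    (behaviour-follows i) (single i) (a i) (a (i ⁺)) (along-a i) (along-a (i ⁺)))
        where
        move-of : ∀ {x o} → lookup (behaviour i) x ≡ o → move i x ≡ o
        move-of = trans (sym (lookup-behaviour i _))
        order-step : ∀ {y y′} → move i (a i ⁺) ≡ across y → move i (a i ⁺ ⁺) ≡ across y′ →
          time (i ⁺) y <ℙ time (i ⁺) y′ ≡ ahead i + wraps i
        order-step leave₁ leave₂ =
          strand-order (s≤s z≤n) (time-along (move-of (along-a i))) (time-across leave₁) (time-across leave₂)
            (injective⇒≢ (time-injective i) (⁺⁺≢id (a i))) (injective⇒≢ (time-injective i) (⁺⁺≢⁺ (a i)))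
        kept : ∀ x w {y} → y ≡ x + w → 0ℙ ≡ x + y + w
        kept 0ℙ 0ℙ refl = refl
        kept 0ℙ 1ℙ refl = refl
        kept 1ℙ 0ℙ refl = refl
        kept 1ℙ 1ℙ refl = refl
        swapped : ∀ x w {y} → y ≡ (x + w) ⁻¹ → 1ℙ ≡ x + y + w
        swapped 0ℙ 0ℙ refl = refl
        swapped 0ℙ 1ℙ refl = refl
        swapped 1ℙ 0ℙ refl = refl
        swapped 1ℙ 1ℙ refl = refl
        from-strands : Strands (behaviour i) (a i) (a (i ⁺)) → twist (behaviour i) ≡ ahead i + ahead (i ⁺) + wraps i
        from-strands (inj₁ (leave₁ , leave₂ , twist≡0ℙ)) =
          trans twist≡0ℙ (kept (ahead i) (wraps i) (order-step (move-of leave₁) (move-of leave₂)))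
        from-strands (inj₂ (leave₁ , leave₂ , twist≡1ℙ)) =
          trans twist≡1ℙ (swapped (ahead i) (wraps i) (trans (<ℙ-flip (injective⇒≢ (time-injective (i ⁺)) (⁺⁺≢id (a (i ⁺))) ∘ sym))
                                                             (cong _⁻¹ (order-step (move-of leave₁) (move-of leave₂)))))

      wraps-indicator : ∀ i → wraps i ≡ χ (i ≟ᶠ lastLayer)
      wraps-indicator i = χ-⇔ reaches-end (λ i≡last → subst AtEnd (sym i≡last) last-atEnd) (atEnd? _ _ _ _) (i ≟ᶠ lastLayer)
        where
        AtEnd : Fin n → Set
        AtEnd i = time i (a i) ≡ M ⊎ time i (a i ⁺) ≡ M ⊎ time i (a i ⁺ ⁺) ≡ M
        reaches-end : AtEnd i → i ≡ lastLayer
        reaches-end (inj₁ e) = time≡M⇒lastLayer e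
        reaches-end (inj₂ (inj₁ e)) = time≡M⇒lastLayer e
        reaches-end (inj₂ (inj₂ e)) = time≡M⇒lastLayer e
        last-atEnd : AtEnd lastLayer
        last-atEnd = map-⊎ at (map-⊎ at at) (⁺-cover (a lastLayer) lastIndex)
          where
          at : ∀ {x} → lastIndex ≡ x → time lastLayer x ≡ M
          at e = subst (λ x → time lastLayer x ≡ M) e time-last

      twist-sum-single : ∑[ i < n ] twist (behaviour i) ≡ 1ℙ
      twist-sum-single = begin
        ∑[ i < n ] twist (behaviour i)                           ≡⟨ sum-cong-≗ twist-step ⟩
        ∑[ i < n ] (ahead i + ahead (i ⁺) + wraps i)             ≡⟨ ∑-distrib-+ (λ i → ahead i + ahead (i ⁺)) wraps ⟩
        ∑[ i < n ] (ahead i + ahead (i ⁺)) + ∑[ i < n ] wraps i  ≡⟨ cong₂ _+_ (∑-telescope ahead) (trans (sum-cong-≗ wraps-indicator) (∑-indicator lastLayer)) ⟩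
        1ℙ                                                       ∎
        where open ≡-Reasoning

    twist-sum : parity n ≡ 0ℙ → ∑[ i < n ] twist (behaviour i) ≡ parity (alongCount (behaviour 0F))
    twist-sum n-even = by-count (alongCount-cases (behaviour 0F) (behaviour-notAllAlong 0F))
      where
      constant : ∀ {m} → alongCount (behaviour 0F) ≡ m → ∀ i → alongCount (behaviour i) ≡ m
      constant e i = trans (alongCount-constant i) e
      by-count : alongCount (behaviour 0F) ≡ 0 ⊎ alongCount (behaviour 0F) ≡ 1 ⊎ alongCount (behaviour 0F) ≡ 2 →
        ∑[ i < n ] twist (behaviour i) ≡ parity (alongCount (behaviour 0F))
      by-count (inj₁ e) =
        trans (sum-cong-≗ (λ i → twist-crossing (behaviour i) (constant e i))) (trans (sum-replicate-zero n) (cong parity (sym e)))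
      by-count (inj₂ (inj₁ e)) = trans (SingleAlong.twist-sum-single (constant e)) (cong parity (sym e))
      by-count (inj₂ (inj₂ e)) =
        trans (sum-cong-≗ (λ i → twist-double (behaviour i) (constant e i))) (trans (∑-1ℙ n) (trans n-even (cong parity (sym e))))

  module Decomposition (D : HamDecomposition G) where
    open HamDecomposition D renaming (k to r)
    open module C j = Cycle (cycles j) using (move; behaviour)

    opaque
      owner : Fin n → Fin 3 → Out → Fin r
      owner i x o = proj₁ (covers (vertex i x) (target i x o) (arc-target i x o))

      move-owner : ∀ i x o → move (owner i x o) i x ≡ o
      move-owner i x o = C.move-unique _ (C.uses⇒next _ (proj₂ (covers (vertex i x) (target i x o) (arc-target i x o))))

      owner-move : ∀ j i x → owner i x (move j i x) ≡ j
      owner-move j i x = disjoint (vertex i x) (target i x (move j i x)) _ j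
        (proj₂ (covers (vertex i x) (target i x (move j i x)) (arc-target i x (move j i x))))
        (C.next⇒uses j (C.next-vertex j i x))

    naming : Fin n → Permutation 4 r
    naming i = permutation (owner i 0F) (λ j → move j i 0F) (λ j → owner-move j i 0F) (move-owner i 0F)

    column : Fin n → Fin 3 → Vec Out 4
    column i x = tabulate λ d → move (owner i 0F d) i x

    lookup-column : ∀ i x d → lookup (column i x) d ≡ move (owner i 0F d) i x
    lookup-column i x = lookup∘tabulate λ d → move (owner i 0F d) i x

    layer : Fin n → Out → Behaviour
    layer i = row (column i 1F) (column i 2F)

    layer-behaviour : ∀ i d → layer i d ≡ behaviour (owner i 0F d) i
    layer-behaviour i d =
      cong₃ (λ o₀ o₁ o₂ → o₀ ∷ o₁ ∷ o₂ ∷ []) (sym (move-owner i 0F d)) (lookup-column i 1F d) (lookup-column i 2F d)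

    column-distinct : ∀ i x → Distinct (column i x)
    column-distinct i x d d′ e = begin
      d                           ≡⟨ move-owner i 0F d ⟨
      move (owner i 0F d) i 0F    ≡⟨ cong (λ j → move j i 0F) same-owner ⟩
      move (owner i 0F d′) i 0F   ≡⟨ move-owner i 0F d′ ⟩
      d′                          ∎
      where
      open ≡-Reasoning
      same-owner : owner i 0F d ≡ owner i 0F d′
      same-owner = begin
        owner i 0F d                           ≡⟨ owner-move (owner i 0F d) i x ⟨
        owner i x (move (owner i 0F d) i x)    ≡⟨ cong (owner i x) (trans (sym (lookup-column i x d)) (trans e (lookup-column i x d′))) ⟩
        owner i x (move (owner i 0F d′) i x)   ≡⟨ owner-move (owner i 0F d′) i x ⟩
        owner i 0F d′                          ∎

    validLayer : ∀ i → ValidLayer (column i 1F) (column i 2F)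
    validLayer i = record
      { distinct₁ = column-distinct i 1F
      ; distinct₂ = column-distinct i 2F
      ; rowsValid = λ d → subst (λ b → AcrossInjective b × ¬ AllAlong b) (sym (layer-behaviour i d))
                              (C.behaviour-acrossInjective _ i , C.behaviour-notAllAlong _ i)
      }

    ∑-layer : ∀ i (f : Behaviour → Parity) → ∑[ d < 4 ] f (layer i d) ≡ ∑[ j < r ] f (behaviour j i)
    ∑-layer i f = trans (sum-cong-≗ (cong f ∘ layer-behaviour i)) (sym (∑-permute (λ j → f (behaviour j i)) (naming i)))

    sign≡∑twist : ∀ j i → alongCount (behaviour j i) ≡ 0 → sign (behaviour j i) ≡ ∑[ j′ < r ] twist (behaviour j′ i)
    sign≡∑twist j i crossing = begin
      sign (behaviour j i)                 ≡⟨ cong sign named ⟨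
      sign (layer i d)                     ≡⟨ layer-sign≡∑twist (column i 1F) (column i 2F) (validLayer i) d (trans (cong alongCount named) crossing) ⟩
      ∑[ d′ < 4 ] twist (layer i d′)       ≡⟨ ∑-layer i twist ⟩
      ∑[ j′ < r ] twist (behaviour j′ i)   ∎
      where
      open ≡-Reasoning
      d = move j i 0F
      named : layer i d ≡ behaviour j i
      named = trans (layer-behaviour i d) (cong (λ j′ → behaviour j′ i) (owner-move j i 0F))

    even⇒0ℙ≡1ℙ : parity n ≡ 0ℙ → 0ℙ ≡ 1ℙ
    even⇒0ℙ≡1ℙ n-even = begin
      0ℙ                                               ≡⟨ C.sign-sum A crossing ⟨
      ∑[ i < n ] sign (behaviour A i)                  ≡⟨ sum-cong-≗ (λ i → sign≡∑twist A i (crossing i)) ⟩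
      ∑[ i < n ] ∑[ j < r ] twist (behaviour j i)      ≡⟨ ∑-comm (λ i j → twist (behaviour j i)) ⟩
      ∑[ j < r ] ∑[ i < n ] twist (behaviour j i)      ≡⟨ sum-cong-≗ (λ j → C.twist-sum j n-even) ⟩
      ∑[ j < r ] parity (alongCount (behaviour j 0F))  ≡⟨ ∑-layer 0F (parity ∘ alongCount) ⟨
      ∑[ d < 4 ] parity (alongCount (layer 0F d))      ≡⟨ alongCount-parity-sum (column 0F 1F) (column 0F 2F) (validLayer 0F) ⟩
      1ℙ                                               ∎
      where
      open ≡-Reasoning
      A-crossing = crossing-exists (column 0F 1F) (column 0F 2F) (validLayer 0F)
      A = owner 0F 0F (proj₁ A-crossing)
      crossing : ∀ i → alongCount (behaviour A i) ≡ 0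
      crossing i = trans (C.alongCount-constant A i) (trans (cong alongCount (sym (layer-behaviour 0F (proj₁ A-crossing)))) (proj₂ A-crossing))

proposition6p4 : (n : ℕ) → n > 0 → 2 ∣ n → ¬ HamiltonianDecomposable (wreath (dcycle n) (dcycle 3))
proposition6p4 zero () _
proposition6p4 (suc zero) _ 2∣1 = contradiction (parity-even 2∣1) λ ()
proposition6p4 (suc (suc k)) _ 2∣n D = contradiction (Wreath.Decomposition.even⇒0ℙ≡1ℙ k D (parity-even 2∣n)) λ ()
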